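{- Let $n,k$ be positive integers with $n \ge 5$ and $k < n/2$, and suppose that $n = 7k/i$ for some $i \in \{1,2,3\}$. Suppose moreover that either $n \ge 42$ or $(n,k) \in \{(28,8),(35,10),(35,15)\}$. Then the cop number of the generalised Petersen graph $GP(n,k)$ is $4$.
   Context: The generalised Petersen graph $GP(n,k)$ (with $n\ge 5$, $1\le k<n/2$) has vertex set $\{a_0,\dots,a_{n-1}\}\cup\{b_0,\dots,b_{n-1}\}$ and edges $\{a_j,a_{j+1}\}$, $\{a_j,b_j\}$, $\{b_j,b_{j+k}\}$ for all $j$, with subscripts taken modulo $n$. The game of cops and robbers on a graph: the cop player places each of their cops on vertices, then the robber places the robber on a vertex; thereafter the players alternate turns (cops first), and on each turn the player may move any or all of their pieces to adjacent vertices (or leave them in place). The cops win if some cop lands on the robber's vertex; the cop number is the minimum number of cops for which the cops have a strategy guaranteeing capture. -}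

module Defs where

open import Data.Nat using (ℕ; _+_; _*_; _<_)
open import Data.Fin using (Fin; toℕ)
open import Data.Sum using (_⊎_; inj₁; inj₂)
open import Data.Product using (Σ; ∃; _×_; _,_)
open import Relation.Binary.PropositionalEquality using (_≡_)
open import Relation.Nullary using (¬_)

-- Generalised Petersen graph GP(n,k)
-- Vertices: inj₁ j = a_j (outer), inj₂ j = b_j (inner), j ∈ Fin n.

GPVertex : ℕ → Set
GPVertex n = Fin n ⊎ Fin n

-- "j ≡ i + d (mod n)" for i, j < n and d < n (here d ∈ {1, k})
PlusMod : (n d : ℕ) → Fin n → Fin n → Set
PlusMod n d i j = (toℕ i + d ≡ toℕ j) ⊎ (toℕ i + d ≡ toℕ j + n)

data GPStep (n k : ℕ) : GPVertex n → GPVertex n → Set where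
  outer : ∀ i j → PlusMod n 1 i j → GPStep n k (inj₁ i) (inj₁ j)
  spoke : ∀ i → GPStep n k (inj₁ i) (inj₂ i)
  inner : ∀ i j → PlusMod n k i j → GPStep n k (inj₂ i) (inj₂ j)

GPAdj : (n k : ℕ) → GPVertex n → GPVertex n → Set
GPAdj n k x y = GPStep n k x y ⊎ GPStep n k y x

module CopsAndRobbers {V : Set} (Adj : V → V → Set) where

  MoveTo : V → V → Set
  MoveTo x y = (x ≡ y) ⊎ Adj x y

  Cops : ℕ → Set
  Cops c = Fin c → V

  CopsMove : ∀ {c} → Cops c → Cops c → Set
  CopsMove cs cs' = ∀ i → MoveTo (cs i) (cs' i)

  -- CopsWin cs r : it is the cops' turn, cops are at cs, robber at r,
  -- and the cops can force capture in finitely many rounds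
  -- (inductive = capture guaranteed after finitely many moves).
  data CopsWin {c : ℕ} (cs : Cops c) (r : V) : Set where
    capture : (cs' : Cops c) → CopsMove cs cs' → (∃ λ i → cs' i ≡ r) → CopsWin cs r
    continue : (cs' : Cops c) → CopsMove cs cs' →
               (∀ r' → MoveTo r r' → CopsWin cs' r') → CopsWin cs r

  CopsHaveWinningStrategy : ℕ → Set
  CopsHaveWinningStrategy c = Σ (Cops c) λ cs → ∀ r → CopsWin cs r

  CopNumberIs : ℕ → Set
  CopNumberIs c = CopsHaveWinningStrategy c × (∀ m → m < c → ¬ CopsHaveWinningStrategy m)

GPCopNumberIs : (n k c : ℕ) → Set
GPCopNumberIs n k c = CopsAndRobbers.CopNumberIs (GPAdj n k) c

{-# OPTIONS --safe #-}

-- Write the index of a vertex as an integer modulo n; 7 divides n and k is a multiple of n / 7.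
--
-- Four cops win on every GP(n,k) with k < n. Two cops stay on the rim on either side of the robber; two
-- further cops shadow him, i.e. are on his level at distances p k and q k on either side, and copy his moves
-- along rim edges and spokes. When he moves along an inner edge or waits on the inner level, the shadows come
-- closer; when he does anything else, the rim cops come closer, so the pair (p + q, distance of the rim cops)
-- decreases lexicographically. To become shadows, two cops run along the rim: they keep their lag when
-- the robber moves along the rim (and the rim cops come closer) and reduce it otherwise.
--
-- Three cops lose. The robber is safe at u if no cop is within distance 1 and some edge at u starts no
-- path of length at most 3 to a cop. After a move of the cops, such an edge p starts no path of length at most 2 to
-- a cop. If stepping along p is not safe, the three cops block the three edges at the other end s of p, one
-- of them within distance 2 of u behind some edge r. If stepping along the third edge q is not safe either, the
-- two remaining cops close two walks of length at most 8 through s, u and the other end of q that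
-- share no further edge there. But the only such closed walks are the inner 7-cycles and the 8-cycles
-- a_j a_{j+1} b_{j+1} b_{j+1+k} a_{j+1+k} a_{j+k} b_{j+k} b_j, and these do not occur in such pairs.
module Submission where

open import Defs
open import Data.Nat as ℕ using (ℕ; zero; suc; NonZero; _≤_; _<_)
import Data.Nat.Properties as ℕ
import Data.Nat.Divisibility as ℕ
open import Data.Nat.Primality using (Prime; prime?; euclidsLemma)
open import Data.Integer using (ℤ; +_; -[1+_]; _+_; _-_; _*_; -_; ∣_∣; 0ℤ; 1ℤ)
import Data.Integer.Properties as ℤ
open import Data.Integer.DivMod using (_%ℕ_; _/ℕ_; n%ℕd<d; a≡a%ℕn+[a/ℕn]*n)
open import Data.Integer.Divisibility.Signed using (_∣_; divides; ∣⇒∣ᵤ; ∣m∣n⇒∣m+n; ∣m⇒∣-m; ∣m∣n⇒∣m-n)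
open import Data.Integer.Tactic.RingSolver using (solve-∀)
open import Data.Fin as Fin using (Fin; toℕ; fromℕ<)
import Data.Fin.Properties as Fin
open import Data.List using (List; []; _∷_; _++_; map)
open import Data.List.Relation.Unary.All as All using (All; []; _∷_)
open import Data.List.Relation.Unary.Any as Any using (Any; here; there)
import Data.List.Relation.Unary.Any.Properties as Any
open import Data.Product using (Σ; ∃; _×_; _,_; proj₁; proj₂)
open import Data.Sum using (_⊎_; inj₁; inj₂)
import Data.Sum.Properties as Sum
open import Data.Empty using (⊥; ⊥-elim)
open import Relation.Binary.PropositionalEquality
open import Relation.Nullary using (¬_; Dec; yes; no; ¬?)
open import Relation.Nullary.Decidable using (map′; from-yes; from-no; _×-dec_; _⊎-dec_; _→-dec_)

-- Integer coordinates modulo `n` for vertices and moves.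

data Level : Set where
  A B : Level

other : Level → Level
other A = B
other B = A

data Port : Set where
  next prev spoke : Port

multiple-small : ∀ {n i j} → i ℕ.∸ j ℕ.< n → n ℕ.∣ i ℕ.∸ j → i ℕ.≤ j
multiple-small {n} {i} {j} d<n n∣d with i ℕ.∸ j in eq
... | zero  = ℕ.m∸n≡0⇒m≤n eq
... | suc d = ⊥-elim (ℕ.>⇒∤ d<n n∣d)

module Cover (n k : ℕ) .{{_ : NonZero n}} where

  abstract
    index : ℤ → Fin n
    index z = fromℕ< (n%ℕd<d z n)

    toℕ-index : ∀ z → toℕ (index z) ≡ z %ℕ n
    toℕ-index z = Fin.toℕ-fromℕ< (n%ℕd<d z n)

    ∣z-index : ∀ z → + n ∣ z - + toℕ (index z)
    ∣z-index z = divides (z /ℕ n) (begin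
      z - + toℕ (index z)                            ≡⟨ cong (λ i → z - + i) (toℕ-index z) ⟩
      z - + (z %ℕ n)                                  ≡⟨ cong (_- + (z %ℕ n)) (a≡a%ℕn+[a/ℕn]*n z n) ⟩
      + (z %ℕ n) + (z /ℕ n) * + n - + (z %ℕ n)       ≡⟨ lemma (+ (z %ℕ n)) ((z /ℕ n) * + n) ⟩
      (z /ℕ n) * + n                                  ∎)
      where
      open ≡-Reasoning
      lemma : ∀ r q → r + q - r ≡ q
      lemma = solve-∀

  vertex : Level → ℤ → GPVertex n
  vertex A z = inj₁ (index z)
  vertex B z = inj₂ (index z)

  ∣-small : ∀ i j → i ℕ.< n → j ℕ.< n → + n ∣ + i - + j → i ≡ j
  ∣-small i j i<n j<n n∣ with ℕ.≤-total i j
  ... | inj₁ i≤j = ℕ.≤-antisym i≤j (multiple-small (ℕ.≤-<-trans (ℕ.m∸n≤m j i) j<n)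
          (subst (n ℕ.∣_) (trans (cong ∣_∣ (ℤ.m-n≡m⊖n i j)) (ℤ.∣⊖∣-≤ i≤j)) (∣⇒∣ᵤ n∣)))
  ... | inj₂ j≤i = ℕ.≤-antisym (multiple-small (ℕ.≤-<-trans (ℕ.m∸n≤m i j) i<n)
          (subst (n ℕ.∣_) (cong ∣_∣ (trans (ℤ.m-n≡m⊖n i j) (ℤ.⊖-≥ j≤i))) (∣⇒∣ᵤ n∣))) j≤i

  index-cong : ∀ {x y} → + n ∣ x - y → index x ≡ index y
  index-cong {x} {y} n∣ = Fin.toℕ-injective
    (∣-small _ _ (Fin.toℕ<n (index x)) (Fin.toℕ<n (index y))
      (subst (+ n ∣_) (lemma x y (+ toℕ (index x)) (+ toℕ (index y)))
        (∣m∣n⇒∣m+n (∣m∣n⇒∣m-n n∣ (∣z-index x)) (∣z-index y))))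
    where
    lemma : ∀ x y i j → (x - y) - (x - i) + (y - j) ≡ i - j
    lemma = solve-∀

  index-injective : ∀ {x y} → index x ≡ index y → + n ∣ x - y
  index-injective {x} {y} eq =
    subst (+ n ∣_) (lemma x y (+ toℕ (index y)))
      (∣m∣n⇒∣m-n (subst (λ i → + n ∣ x - + toℕ i) eq (∣z-index x)) (∣z-index y))
    where
    lemma : ∀ x y i → (x - i) - (y - i) ≡ x - y
    lemma = solve-∀

  index-toℕ : ∀ i → index (+ toℕ i) ≡ i
  index-toℕ i = Fin.toℕ-injective
    (sym (∣-small _ _ (Fin.toℕ<n i) (Fin.toℕ<n (index (+ toℕ i))) (∣z-index (+ toℕ i))))

  vertex-cong : ∀ l {x y} → + n ∣ x - y → vertex l x ≡ vertex l y
  vertex-cong A n∣ = cong inj₁ (index-cong n∣)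
  vertex-cong B n∣ = cong inj₂ (index-cong n∣)

  vertex-injective : ∀ l m {x y} → vertex l x ≡ vertex m y → l ≡ m × + n ∣ x - y
  vertex-injective A A eq = refl , index-injective (inj₁-inj eq)
    where
    inj₁-inj : ∀ {i j : Fin n} → _≡_ {A = GPVertex n} (inj₁ i) (inj₁ j) → i ≡ j
    inj₁-inj refl = refl
  vertex-injective B B eq = refl , index-injective (inj₂-inj eq)
    where
    inj₂-inj : ∀ {i j : Fin n} → _≡_ {A = GPVertex n} (inj₂ i) (inj₂ j) → i ≡ j
    inj₂-inj refl = refl

  vertex-surjective : ∀ v → ∃ λ l → ∃ λ z → v ≡ vertex l z
  vertex-surjective (inj₁ i) = A , + toℕ i , cong inj₁ (sym (index-toℕ i))
  vertex-surjective (inj₂ i) = B , + toℕ i , cong inj₂ (sym (index-toℕ i))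

  PlusMod-sound : ∀ {d i j} → PlusMod n d i j → + n ∣ + toℕ i + + d - + toℕ j
  PlusMod-sound {d} {i} {j} (inj₁ eq) = divides 0ℤ
    (trans (cong (_- + toℕ j) (cong +_ eq)) (ℤ.+-inverseʳ (+ toℕ j)))
  PlusMod-sound {d} {i} {j} (inj₂ eq) = divides 1ℤ
    (trans (cong (_- + toℕ j) (cong +_ eq)) (lemma (+ toℕ j) (+ n)))
    where
    lemma : ∀ j n → j + n - j ≡ 1ℤ * n
    lemma = solve-∀

  -- Since `i` and `d` are both below `n`, their sum is below `2 n`, so subtracting `n` at most once
  -- reduces it.
  PlusMod-complete : ∀ {d i j} → d ℕ.< n → + n ∣ + toℕ i + + d - + toℕ j → PlusMod n d i j
  PlusMod-complete {d} {i} {j} d<n n∣ with toℕ i ℕ.+ d ℕ.<? n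
  ... | yes s<n = inj₁ (∣-small _ _ s<n (Fin.toℕ<n j) n∣)
  ... | no  s≮n = inj₂ (trans (sym (ℕ.m∸n+n≡m n≤s)) (cong (ℕ._+ n)
        (∣-small s (toℕ j) s<n (Fin.toℕ<n j)
          (subst (+ n ∣_) shift (∣m∣n⇒∣m-n n∣ (divides 1ℤ (sym (ℤ.*-identityˡ (+ n)))))))))
    where
    n≤s = ℕ.≮⇒≥ s≮n
    s = toℕ i ℕ.+ d ℕ.∸ n
    s<n : s ℕ.< n
    s<n = ℕ.+-cancelʳ-< n s n (subst (ℕ._< n ℕ.+ n) (sym (ℕ.m∸n+n≡m n≤s)) (ℕ.+-mono-< (Fin.toℕ<n i) d<n))
    lemma : ∀ s n j → (s + n) - j - n ≡ s - j
    lemma = solve-∀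
    shift : + toℕ i + + d - + toℕ j - + n ≡ + s - + toℕ j
    shift = trans (cong (λ t → + t - + toℕ j - + n) (sym (ℕ.m∸n+n≡m n≤s))) (lemma (+ s) (+ n) (+ toℕ j))

  PlusMod-index : ∀ {d} x y → d ℕ.< n → + n ∣ x + + d - y → PlusMod n d (index x) (index y)
  PlusMod-index {d} x y d<n n∣ = PlusMod-complete d<n
    (subst (+ n ∣_) (lemma x y (+ toℕ (index x)) (+ toℕ (index y)) (+ d))
      (∣m∣n⇒∣m+n (∣m∣n⇒∣m-n n∣ (∣z-index x)) (∣z-index y)))
    where
    lemma : ∀ x y i j d → (x + d - y) - (x - i) + (y - j) ≡ i + d - j
    lemma = solve-∀

  PlusMod-successor : ∀ {d j} x → PlusMod n d (index x) j → j ≡ index (x + + d)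
  PlusMod-successor {d} {j} x pm = trans (sym (index-toℕ j)) (index-cong
    (subst (+ n ∣_) (lemma x (+ toℕ (index x)) (+ toℕ j) (+ d))
      (∣m⇒∣-m (∣m∣n⇒∣m+n (∣z-index x) (PlusMod-sound {d} {index x} {j} pm)))))
    where
    lemma : ∀ x i j d → - ((x - i) + (i + d - j)) ≡ j - (x + d)
    lemma = solve-∀

  PlusMod-predecessor : ∀ {d i} y → PlusMod n d i (index y) → i ≡ index (y - + d)
  PlusMod-predecessor {d} {i} y pm = trans (sym (index-toℕ i)) (index-cong
    (subst (+ n ∣_) (lemma y (+ toℕ (index y)) (+ toℕ i) (+ d))
      (∣m∣n⇒∣m-n (PlusMod-sound {d} {i} {index y} pm) (∣z-index y))))
    where
    lemma : ∀ y j i d → (i + d - j) - (y - j) ≡ i - (y - d)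
    lemma = solve-∀

  -- A vertex with an integer lift of its index: steps become additions of integers, and reduction
  -- modulo `n` happens only in `π`.
  State : Set
  State = Level × ℤ

  π : State → GPVertex n
  π (l , z) = vertex l z

  stride : Level → ℤ
  stride A = 1ℤ
  stride B = + k

  step : Port → State → State
  step next  (l , z) = l , z + stride l
  step prev  (l , z) = l , z - stride l
  step spoke (l , z) = other l , z

  open CopsAndRobbers (GPAdj n k) public

  MoveTo-sym : ∀ {v w} → MoveTo v w → MoveTo w v
  MoveTo-sym (inj₁ eq)       = inj₁ (sym eq)
  MoveTo-sym (inj₂ (inj₁ e)) = inj₂ (inj₂ e)
  MoveTo-sym (inj₂ (inj₂ e)) = inj₂ (inj₁ e)

  neighbours : ∀ u {v} → MoveTo (π u) v → v ≡ π u ⊎ ∃ λ p → v ≡ π (step p u)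
  neighbours (l , z) (inj₁ eq)                       = inj₁ (sym eq)
  neighbours (A , z) (inj₂ (inj₁ (outer _ _ pm)))    = inj₂ (next , cong inj₁ (PlusMod-successor z pm))
  neighbours (A , z) (inj₂ (inj₁ (spoke _)))         = inj₂ (spoke , refl)
  neighbours (A , z) (inj₂ (inj₂ (outer _ _ pm)))    = inj₂ (prev , cong inj₁ (PlusMod-predecessor z pm))
  neighbours (B , z) (inj₂ (inj₁ (inner _ _ pm)))    = inj₂ (next , cong inj₂ (PlusMod-successor z pm))
  neighbours (B , z) (inj₂ (inj₂ (spoke _)))         = inj₂ (spoke , refl)
  neighbours (B , z) (inj₂ (inj₂ (inner _ _ pm)))    = inj₂ (prev , cong inj₂ (PlusMod-predecessor z pm))

  module Moves (1<n : 1 ℕ.< n) (k<n : k ℕ.< n) where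

    n∣0 : ∀ {z} → z ≡ 0ℤ → + n ∣ z
    n∣0 eq = divides 0ℤ eq

    forward : ∀ l x y → + n ∣ x + stride l - y → GPStep n k (vertex l x) (vertex l y)
    forward A x y n∣ = outer _ _ (PlusMod-index x y 1<n n∣)
    forward B x y n∣ = inner _ _ (PlusMod-index x y k<n n∣)

    MoveTo-stay : ∀ l {x y} → + n ∣ x - y → MoveTo (vertex l x) (vertex l y)
    MoveTo-stay l n∣ = inj₁ (vertex-cong l n∣)

    MoveTo-next : ∀ l {x y} → + n ∣ x + stride l - y → MoveTo (vertex l x) (vertex l y)
    MoveTo-next l n∣ = inj₂ (inj₁ (forward l _ _ n∣))

    MoveTo-prev : ∀ l {x y} → + n ∣ y + stride l - x → MoveTo (vertex l x) (vertex l y)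
    MoveTo-prev l n∣ = inj₂ (inj₂ (forward l _ _ n∣))

    MoveTo-spoke : ∀ l {x y} → + n ∣ x - y → MoveTo (vertex l x) (vertex (other l) y)
    MoveTo-spoke A {x} {y} n∣ = subst (λ v → MoveTo v (vertex B y)) (sym (vertex-cong A n∣)) (inj₂ (inj₁ (spoke _)))
    MoveTo-spoke B {x} {y} n∣ = subst (MoveTo (vertex B x)) (vertex-cong A n∣) (inj₂ (inj₂ (spoke _)))

    step-adjacent : ∀ p u → MoveTo (π u) (π (step p u))
    step-adjacent next  (l , z) = MoveTo-next l (n∣0 (ℤ.+-inverseʳ (z + stride l)))
    step-adjacent prev  (l , z) = MoveTo-prev l (n∣0 (lemma z (stride l)))
      where
      lemma : ∀ z s → z - s + s - z ≡ 0ℤ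
      lemma = solve-∀
    step-adjacent spoke (l , z) = MoveTo-spoke l (n∣0 (ℤ.+-inverseʳ z))

-- A winning strategy for four cops.

module Pursuit (n k : ℕ) .{{_ : NonZero n}} (1<n : 1 ℕ.< n) (k<n : k ℕ.< n) where

  open Cover n k
  open Moves 1<n k<n

  -- The unit of distance `d` is independent of the level: it is 1 for the rim cops and stays `k`
  -- for the shadows even while they are on the rim.
  left right : Level → ℤ → ℤ → ℕ → GPVertex n
  left  l d z a = vertex l (z + - (+ a * d))
  right l d z a = vertex l (z + + a * d)

  -- Distance, along the rim, between a rim cop and the spoke of a robber on level l; it is positive
  -- if the robber is on the rim, since otherwise he is caught.
  gap : Level → ℕ → ℕ
  gap A a = suc a
  gap B a = a

  cops : (v₁ v₂ v₃ v₄ : GPVertex n) → Cops 4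
  cops v₁ v₂ v₃ v₄ Fin.zero                               = v₁
  cops v₁ v₂ v₃ v₄ (Fin.suc Fin.zero)                     = v₂
  cops v₁ v₂ v₃ v₄ (Fin.suc (Fin.suc Fin.zero))           = v₃
  cops v₁ v₂ v₃ v₄ (Fin.suc (Fin.suc (Fin.suc Fin.zero))) = v₄

  cops-move : ∀ {v₁ v₂ v₃ v₄ w₁ w₂ w₃ w₄} → MoveTo v₁ w₁ → MoveTo v₂ w₂ → MoveTo v₃ w₃ → MoveTo v₄ w₄ →
              CopsMove (cops v₁ v₂ v₃ v₄) (cops w₁ w₂ w₃ w₄)
  cops-move m₁ m₂ m₃ m₄ Fin.zero                               = m₁
  cops-move m₁ m₂ m₃ m₄ (Fin.suc Fin.zero)                     = m₂
  cops-move m₁ m₂ m₃ m₄ (Fin.suc (Fin.suc Fin.zero))           = m₃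
  cops-move m₁ m₂ m₃ m₄ (Fin.suc (Fin.suc (Fin.suc Fin.zero))) = m₄

  capture-by : ∀ {cs : Cops 4} {r} i → MoveTo (cs i) r → CopsWin cs r
  capture-by {cs} {r} i m = capture cs′ (λ j → move j) (i , caught)
    where
    cs′ : Cops 4
    cs′ j with j Fin.≟ i
    ... | yes _ = r
    ... | no  _ = cs j
    move : CopsMove cs cs′
    move j with j Fin.≟ i
    ... | yes refl = m
    ... | no  _    = inj₁ refl
    caught : cs′ i ≡ r
    caught with i Fin.≟ i
    ... | yes _  = refl
    ... | no i≢i = ⊥-elim (i≢i refl)

  -- The outcome of one turn: a capture is possible, or both cops move in and the sum of their
  -- distances falls. `γ` encodes which distances the invariant allows.
  Squeezed : Level → ℤ → (v w : GPVertex n) → Level → ℤ → (ℕ → ℕ) → ℕ → Set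
  Squeezed l z v w m d γ t =
    (MoveTo v (vertex l z) ⊎ MoveTo w (vertex l z)) ⊎
    ∃ λ a → ∃ λ b → MoveTo v (left m d z (γ a)) × MoveTo w (right m d z (γ b)) × γ a ℕ.+ γ b ℕ.< t

  approach-left : ∀ l z a → MoveTo (left l (stride l) z (suc a)) (left l (stride l) z a)
  approach-left l z a = MoveTo-next l (n∣0 (lemma z (+ a) (stride l)))
    where
    lemma : ∀ z a s → z + - ((1ℤ + a) * s) + s - (z + - (a * s)) ≡ 0ℤ
    lemma = solve-∀

  approach-right : ∀ l z a → MoveTo (right l (stride l) z (suc a)) (right l (stride l) z a)
  approach-right l z a = MoveTo-prev l (n∣0 (lemma z (+ a) (stride l)))
    where
    lemma : ∀ z a s → z + a * s + s - (z + (1ℤ + a) * s) ≡ 0ℤ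
    lemma = solve-∀

  left-zero : ∀ l d z → left l d z 0 ≡ vertex l z
  left-zero l d z = cong (vertex l) (lemma z d)
    where
    lemma : ∀ z d → z + - (0ℤ * d) ≡ z
    lemma = solve-∀

  right-zero : ∀ l d z → right l d z 0 ≡ vertex l z
  right-zero l d z = cong (vertex l) (lemma z d)
    where
    lemma : ∀ z d → z + 0ℤ * d ≡ z
    lemma = solve-∀

  -- At distance 0 or 1 a cop captures; from greater distances both step inward and stay at positive
  -- distance.
  squeeze : ∀ l z a b → Squeezed l z (left l (stride l) z a) (right l (stride l) z b) l (stride l) suc (a ℕ.+ b)
  squeeze l z zero          b             = inj₁ (inj₁ (inj₁ (left-zero l (stride l) z)))
  squeeze l z (suc zero)    b             = inj₁ (inj₁ (subst (MoveTo _) (left-zero l (stride l) z) (approach-left l z 0)))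
  squeeze l z (suc (suc a)) zero          = inj₁ (inj₂ (inj₁ (right-zero l (stride l) z)))
  squeeze l z (suc (suc a)) (suc zero)    = inj₁ (inj₂ (subst (MoveTo _) (right-zero l (stride l) z) (approach-right l z 0)))
  squeeze l z (suc (suc a)) (suc (suc b)) =
    inj₂ (a , b , approach-left l z (suc a) , approach-right l z (suc b) , ℕ.+-mono-< (ℕ.n<1+n (suc a)) (ℕ.n<1+n (suc b)))

  -- Against a robber on the inner level, a rim cop at distance zero stands at the other end of his
  -- spoke and captures along it; otherwise both rim cops step inward, possibly to distance zero.
  squeeze-rim : ∀ l z a b → Squeezed l z (left A 1ℤ z a) (right A 1ℤ z b) A 1ℤ (gap l) (a ℕ.+ b)
  squeeze-rim A z a       b       = squeeze A z a b
  squeeze-rim B z zero    b       = inj₁ (inj₁ (subst (λ v → MoveTo v (vertex B z)) (sym (left-zero A 1ℤ z)) (step-adjacent spoke (A , z))))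
  squeeze-rim B z (suc a) zero    = inj₁ (inj₂ (subst (λ v → MoveTo v (vertex B z)) (sym (right-zero A 1ℤ z)) (step-adjacent spoke (A , z))))
  squeeze-rim B z (suc a) (suc b) =
    inj₂ (a , b , approach-left A z a , approach-right A z b , ℕ.+-mono-< (ℕ.n<1+n a) (ℕ.n<1+n b))

  follow : ∀ p l z c → let (l′ , z′) = step p (l , z) in MoveTo (vertex l (z + c)) (vertex l′ (z′ + c))
  follow next  l z c = MoveTo-next l (n∣0 (lemma z c (stride l)))
    where
    lemma : ∀ z c s → z + c + s - (z + s + c) ≡ 0ℤ
    lemma = solve-∀
  follow prev  l z c = MoveTo-prev l (n∣0 (lemma z c (stride l)))
    where
    lemma : ∀ z c s → z - s + c + s - (z + c) ≡ 0ℤ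
    lemma = solve-∀
  follow spoke l z c = step-adjacent spoke (l , z + c)

  -- A round in which the rim cops make the progress. Their positions enter through equations, so
  -- that distances from the robber's former place can be restated from `z`.
  chase : ∀ {v₁ v₂ v₃ v₄ w₃ w₄} l z a b → v₁ ≡ left A 1ℤ z a → v₂ ≡ right A 1ℤ z b →
          MoveTo v₃ w₃ → MoveTo v₄ w₄ →
          (∀ a′ b′ → gap l a′ ℕ.+ gap l b′ ℕ.< a ℕ.+ b → ∀ r → MoveTo (vertex l z) r →
             CopsWin (cops (left A 1ℤ z (gap l a′)) (right A 1ℤ z (gap l b′)) w₃ w₄) r) →
          CopsWin (cops v₁ v₂ v₃ v₄) (vertex l z)
  chase l z a b refl refl m₃ m₄ win with squeeze-rim l z a b
  ... | inj₁ (inj₁ m)                        = capture-by Fin.zero m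
  ... | inj₁ (inj₂ m)                        = capture-by (Fin.suc Fin.zero) m
  ... | inj₂ (a′ , b′ , m₁ , m₂ , decrease) =
    continue _ (cops-move m₁ m₂ m₃ m₄) (win a′ b′ decrease)

  positive-residue : ∀ d → ∃ λ a → + n ∣ d - + suc a
  -- Adding a full `n` to the remainder keeps the representative positive even when `n` divides `d`.
  positive-residue d = d %ℕ n ℕ.+ ℕ.pred n , divides (d /ℕ n - 1ℤ) (begin
    d - + suc (d %ℕ n ℕ.+ ℕ.pred n)                             ≡⟨ cong (λ i → d - + i) (trans (sym (ℕ.+-suc (d %ℕ n) (ℕ.pred n))) (cong (d %ℕ n ℕ.+_) (ℕ.suc-pred n))) ⟩
    d - (+ (d %ℕ n) + + n)                                      ≡⟨ cong (_- (+ (d %ℕ n) + + n)) (a≡a%ℕn+[a/ℕn]*n d n) ⟩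
    + (d %ℕ n) + (d /ℕ n) * + n - (+ (d %ℕ n) + + n)            ≡⟨ lemma (+ (d %ℕ n)) (d /ℕ n) (+ n) ⟩
    (d /ℕ n - 1ℤ) * + n                                         ∎)
    where
    open ≡-Reasoning
    lemma : ∀ r q n → r + q * n - (r + n) ≡ (q - 1ℤ) * n
    lemma = solve-∀

  -- Modulo `n` the coefficient `c` has positive and negative representatives, so one position
  -- counts as lying on either side of the robber.
  as-left : ∀ l d z c → ∃ λ a → vertex l (z + c * d) ≡ left l d z (suc a)
  as-left l d z c with positive-residue (- c)
  ... | a , divides q eq = a , vertex-cong l (divides (- q * d) (trans (lemma z c d (+ suc a)) (trans (cong (λ t → - t * d) eq) (lemma′ q d (+ n)))))
    where
    lemma : ∀ z c d a → z + c * d - (z + - (a * d)) ≡ - (- c - a) * d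
    lemma = solve-∀
    lemma′ : ∀ q d n → - (q * n) * d ≡ - q * d * n
    lemma′ = solve-∀

  as-right : ∀ l d z c → ∃ λ a → vertex l (z + c * d) ≡ right l d z (suc a)
  as-right l d z c with positive-residue c
  ... | a , divides q eq = a , vertex-cong l (divides (q * d) (trans (lemma z c d (+ suc a)) (trans (cong (_* d) eq) (lemma′ q d (+ n)))))
    where
    lemma : ∀ z c d a → z + c * d - (z + a * d) ≡ (c - a) * d
    lemma = solve-∀
    lemma′ : ∀ q d n → q * n * d ≡ q * d * n
    lemma′ = solve-∀

  gap-positive : ∀ l a → ∃ λ b → gap l b ≡ suc a
  gap-positive A a = a , refl
  gap-positive B a = suc a , refl

  at-displacement : ∀ x z → z + (x - z) * 1ℤ ≡ x
  at-displacement = solve-∀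

  regroup-left : ∀ l x z → ∃ λ a → vertex A x ≡ left A 1ℤ z (gap l a)
  regroup-left l x z with as-left A 1ℤ z (x - z)
  ... | a , eq with gap-positive l a
  ...   | b , gap≡ = b , trans (sym (cong (vertex A) (at-displacement x z))) (trans eq (cong (left A 1ℤ z) (sym gap≡)))

  regroup-right : ∀ l x z → ∃ λ a → vertex A x ≡ right A 1ℤ z (gap l a)
  regroup-right l x z with as-right A 1ℤ z (x - z)
  ... | a , eq with gap-positive l a
  ...   | b , gap≡ = b , trans (sym (cong (vertex A) (at-displacement x z))) (trans eq (cong (right A 1ℤ z) (sym gap≡)))

  -- For rounds in which the other two cops make the progress: the rim cops stay put and are
  -- measured afresh from the robber's new place, so their distances may grow.
  regroup : ∀ {v₃ v₄ w₃ w₄} l z x₁ x₂ → MoveTo v₃ w₃ → MoveTo v₄ w₄ →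
            (∀ a b r → MoveTo (vertex l z) r →
               CopsWin (cops (left A 1ℤ z (gap l a)) (right A 1ℤ z (gap l b)) w₃ w₄) r) →
            CopsWin (cops (vertex A x₁) (vertex A x₂) v₃ v₄) (vertex l z)
  regroup l z x₁ x₂ m₃ m₄ win with regroup-left l x₁ z | regroup-right l x₂ z
  ... | a , eq₁ | b , eq₂ = continue _ (cops-move (inj₁ eq₁) (inj₁ eq₂) m₃ m₄) (win a b)

  shadowing : (l : Level) (z : ℤ) (a b p q : ℕ) → Cops 4
  shadowing l z a b p q = cops (left A 1ℤ z (gap l a)) (right A 1ℤ z (gap l b))
                               (left l (+ k) z (suc p)) (right l (+ k) z (suc q))

  -- On the inner level the robber's stride is `k`, the unit of the shadows' distances, so here the
  -- shadows can squeeze him.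
  corner : ∀ {v₃ v₄} z x₁ x₂ p q → v₃ ≡ left B (+ k) z p → v₄ ≡ right B (+ k) z q →
           (∀ a b p′ q′ → suc p′ ℕ.+ suc q′ ℕ.< p ℕ.+ q → ∀ r → MoveTo (vertex B z) r →
              CopsWin (shadowing B z a b p′ q′) r) →
           CopsWin (cops (vertex A x₁) (vertex A x₂) v₃ v₄) (vertex B z)
  corner z x₁ x₂ p q refl refl win with squeeze B z p q
  ... | inj₁ (inj₁ m)                        = capture-by (Fin.suc (Fin.suc Fin.zero)) m
  ... | inj₁ (inj₂ m)                        = capture-by (Fin.suc (Fin.suc (Fin.suc Fin.zero))) m
  ... | inj₂ (p′ , q′ , m₃ , m₄ , decrease) =
    regroup B z x₁ x₂ m₃ m₄ (λ a b → win a b p′ q′ decrease)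

  left-after-next : ∀ l d z a → left l d z a ≡ left l d (z + d) (suc a)
  left-after-next l d z a = cong (vertex l) (lemma d z (+ a))
    where
    lemma : ∀ d z a → z + - (a * d) ≡ z + d + - ((1ℤ + a) * d)
    lemma = solve-∀

  right-after-next : ∀ l d z a → right l d z (suc a) ≡ right l d (z + d) a
  right-after-next l d z a = cong (vertex l) (lemma d z (+ a))
    where
    lemma : ∀ d z a → z + (1ℤ + a) * d ≡ z + d + a * d
    lemma = solve-∀

  left-after-prev : ∀ l d z a → left l d z (suc a) ≡ left l d (z - d) a
  left-after-prev l d z a = cong (vertex l) (lemma d z (+ a))
    where
    lemma : ∀ d z a → z + - ((1ℤ + a) * d) ≡ z - d + - (a * d)
    lemma = solve-∀

  right-after-prev : ∀ l d z a → right l d z a ≡ right l d (z - d) (suc a)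
  right-after-prev l d z a = cong (vertex l) (lemma d z (+ a))
    where
    lemma : ∀ d z a → z + a * d ≡ z - d + (1ℤ + a) * d
    lemma = solve-∀

  -- A step of the robber lengthens one distance and shortens the other by one, so the sum to be
  -- beaten is unchanged.
  after-next : ∀ {m g} a b → m ℕ.< suc (suc a) ℕ.+ b → suc a ℕ.+ suc b ℕ.≤ g → m ℕ.< g
  after-next a b lt le = ℕ.<-≤-trans lt (ℕ.≤-trans (ℕ.≤-reflexive (cong suc (sym (ℕ.+-suc a b)))) le)

  after-prev : ∀ {m g} a b → m ℕ.< a ℕ.+ suc (suc b) → suc a ℕ.+ suc b ℕ.≤ g → m ℕ.< g
  after-prev a b lt le = ℕ.<-≤-trans lt (ℕ.≤-trans (ℕ.≤-reflexive (ℕ.+-suc a (suc b))) le)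

  -- `f` and `g` are strict bounds for the sums of the shadow and rim distances. Each round lowers
  -- `f`, or keeps `f` and lowers `g`, which makes the lexicographic recursion structural.
  shadowing-wins : ∀ f g l z a b p q → suc p ℕ.+ suc q ℕ.< f → gap l a ℕ.+ gap l b ℕ.< g →
                   ∀ r → MoveTo (vertex l z) r → CopsWin (shadowing l z a b p q) r

  shadowing-reply : ∀ f g l z a b p q → suc p ℕ.+ suc q ℕ.< f → gap l a ℕ.+ gap l b ℕ.< g →
                    ∀ r → r ≡ vertex l z ⊎ (∃ λ s → r ≡ π (step s (l , z))) →
                    CopsWin (shadowing l z a b p q) r

  shadowing-wins f g l z a b p q pq< ab< r move = shadowing-reply f g l z a b p q pq< ab< r (neighbours (l , z) move)

  shadowing-reply (suc f) (suc g) A z a b p q pq< (ℕ.s≤s ab≤) r (inj₁ refl) =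
    chase A z (suc a) (suc b) refl refl (inj₁ refl) (inj₁ refl)
      (λ a′ b′ lt → shadowing-wins (suc f) g A z a′ b′ p q pq< (ℕ.<-≤-trans lt ab≤))
  shadowing-reply (suc f) (suc g) A z a b p q pq< (ℕ.s≤s ab≤) r (inj₂ (next , refl)) =
    chase A (z + 1ℤ) (suc (suc a)) b (left-after-next A 1ℤ z (suc a)) (right-after-next A 1ℤ z b)
      (follow next A z _) (follow next A z _)
      (λ a′ b′ lt → shadowing-wins (suc f) g A (z + 1ℤ) a′ b′ p q pq< (after-next a b lt ab≤))
  shadowing-reply (suc f) (suc g) A z a b p q pq< (ℕ.s≤s ab≤) r (inj₂ (prev , refl)) =
    chase A (z - 1ℤ) a (suc (suc b)) (left-after-prev A 1ℤ z a) (right-after-prev A 1ℤ z (suc b))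
      (follow prev A z _) (follow prev A z _)
      (λ a′ b′ lt → shadowing-wins (suc f) g A (z - 1ℤ) a′ b′ p q pq< (after-prev a b lt ab≤))
  shadowing-reply (suc f) (suc g) A z a b p q pq< (ℕ.s≤s ab≤) r (inj₂ (spoke , refl)) =
    chase B z (suc a) (suc b) refl refl (follow spoke A z _) (follow spoke A z _)
      (λ a′ b′ lt → shadowing-wins (suc f) g B z a′ b′ p q pq< (ℕ.<-≤-trans lt ab≤))
  shadowing-reply (suc f) (suc g) B z a b p q pq< (ℕ.s≤s ab≤) r (inj₂ (spoke , refl)) =
    chase A z a b refl refl (follow spoke B z _) (follow spoke B z _)
      (λ a′ b′ lt → shadowing-wins (suc f) g A z a′ b′ p q pq< (ℕ.<-≤-trans lt ab≤))
  -- From here on `f` drops, and the bound on the rim sum is reset to its new value plus one.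
  shadowing-reply (suc f) (suc g) B z a b p q (ℕ.s≤s pq≤) ab< r (inj₁ refl) =
    corner z _ _ (suc p) (suc q) refl refl
      (λ a′ b′ p′ q′ lt → shadowing-wins f _ B z a′ b′ p′ q′ (ℕ.<-≤-trans lt pq≤) (ℕ.n<1+n _))
  shadowing-reply (suc f) (suc g) B z a b p q (ℕ.s≤s pq≤) ab< r (inj₂ (next , refl)) =
    corner (z + + k) _ _ (suc (suc p)) q (left-after-next B (+ k) z (suc p)) (right-after-next B (+ k) z q)
      (λ a′ b′ p′ q′ lt → shadowing-wins f _ B (z + + k) a′ b′ p′ q′ (after-next p q lt pq≤) (ℕ.n<1+n _))
  shadowing-reply (suc f) (suc g) B z a b p q (ℕ.s≤s pq≤) ab< r (inj₂ (prev , refl)) =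
    corner (z - + k) _ _ p (suc (suc q)) (left-after-prev B (+ k) z p) (right-after-prev B (+ k) z (suc q))
      (λ a′ b′ p′ q′ lt → shadowing-wins f _ B (z - + k) a′ b′ p′ q′ (after-prev p q lt pq≤) (ℕ.n<1+n _))

  -- Displacement from the robber of the two cops on their way to become shadows: `e` rim steps
  -- short of a multiple of `k`.
  lag : ℕ → ℤ → ℤ
  lag e p = - (+ e) + p * + k

  catching-up : (l : Level) (z : ℤ) (a b e : ℕ) (p : ℤ) → Cops 4
  catching-up l z a b e p = cops (left A 1ℤ z (gap l a)) (right A 1ℤ z (gap l b))
                                 (vertex A (z + lag e p)) (vertex A (z + lag e p))

  -- The two runners arrive together; their common vertex serves as the left and as the right
  -- shadow.
  shadow : ∀ l z x p → vertex l x ≡ vertex l (z + p * + k) →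
           ∃ λ a → ∃ λ b → vertex l x ≡ left l (+ k) z (suc a) × vertex l x ≡ right l (+ k) z (suc b)
  shadow l z x p eq with as-left l (+ k) z p | as-right l (+ k) z p
  ... | a , eqˡ | b , eqʳ = a , b , trans eq eqˡ , trans eq eqʳ

  drop-to : ∀ l x → MoveTo (vertex A x) (vertex l x)
  drop-to A x = inj₁ refl
  drop-to B x = step-adjacent spoke (A , x)

  -- Rim steps of the robber are copied by the runners while the rim cops squeeze, lowering `g`. Any
  -- other reply shifts `z` by a multiple of `k`, which `p` absorbs, and `gain` uses the turn to
  -- lower `e`.
  catching-up-wins : ∀ e g l z a b p → gap l a ℕ.+ gap l b ℕ.< g →
                     ∀ r → MoveTo (vertex l z) r → CopsWin (catching-up l z a b e p) r

  gain : ∀ e z p l z′ δ x₁ x₂ → z′ ≡ z + δ * + k →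
         CopsWin (cops (vertex A x₁) (vertex A x₂) (vertex A (z + lag e p)) (vertex A (z + lag e p))) (vertex l z′)

  catching-up-wins e (suc g) l z a b p ab< r move with neighbours (l , z) move
  catching-up-wins e (suc g) l z a b p ab< r move | inj₁ refl = gain e z p l z 0ℤ _ _ (lemma z (+ k))
    where
    lemma : ∀ z k → z ≡ z + 0ℤ * k
    lemma = solve-∀
  catching-up-wins e (suc g) l z a b p ab< r move | inj₂ (spoke , refl) = gain e z p (other l) z 0ℤ _ _ (lemma z (+ k))
    where
    lemma : ∀ z k → z ≡ z + 0ℤ * k
    lemma = solve-∀
  catching-up-wins e (suc g) A z a b p (ℕ.s≤s ab≤) r move | inj₂ (next , refl) =
    chase A (z + 1ℤ) (suc (suc a)) b (left-after-next A 1ℤ z (suc a)) (right-after-next A 1ℤ z b)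
      (follow next A z _) (follow next A z _)
      (λ a′ b′ lt → catching-up-wins e g A (z + 1ℤ) a′ b′ p (after-next a b lt ab≤))
  catching-up-wins e (suc g) A z a b p (ℕ.s≤s ab≤) r move | inj₂ (prev , refl) =
    chase A (z - 1ℤ) a (suc (suc b)) (left-after-prev A 1ℤ z a) (right-after-prev A 1ℤ z (suc b))
      (follow prev A z _) (follow prev A z _)
      (λ a′ b′ lt → catching-up-wins e g A (z - 1ℤ) a′ b′ p (after-prev a b lt ab≤))
  catching-up-wins e (suc g) B z a b p ab< r move | inj₂ (next , refl) = gain e z p B (z + + k) 1ℤ _ _ (lemma z (+ k))
    where
    lemma : ∀ z k → z + k ≡ z + 1ℤ * k
    lemma = solve-∀
  catching-up-wins e (suc g) B z a b p ab< r move | inj₂ (prev , refl) = gain e z p B (z - + k) (- 1ℤ) _ _ (lemma z (+ k))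
    where
    lemma : ∀ z k → z - k ≡ z + (- 1ℤ) * k
    lemma = solve-∀

  gain (suc e) z p l z′ δ x₁ x₂ refl =
    regroup l z′ x₁ x₂ advance advance (λ a b → catching-up-wins e _ l z′ a b (p - δ) (ℕ.n<1+n _))
    where
    lemma : ∀ z e p δ k → z + (- (1ℤ + e) + p * k) + 1ℤ - (z + δ * k + (- e + (p - δ) * k)) ≡ 0ℤ
    lemma = solve-∀
    advance : MoveTo (vertex A (z + lag (suc e) p)) (vertex A (z′ + lag e (p - δ)))
    advance = MoveTo-next A (n∣0 (lemma z (+ e) p δ (+ k)))
  -- The displacement is already a multiple of `k`, so the turn is spent on reaching the robber's
  -- level.
  gain zero z p l z′ δ x₁ x₂ refl with shadow l z′ (z + lag 0 p) (p - δ) (cong (vertex l) (lemma z p δ (+ k)))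
    where
    lemma : ∀ z p δ k → z + (0ℤ + p * k) ≡ z + δ * k + (p - δ) * k
    lemma = solve-∀
  ... | a , b , eqˡ , eqʳ =
    regroup l z′ x₁ x₂ (subst (MoveTo _) eqˡ (drop-to l _)) (subst (MoveTo _) eqʳ (drop-to l _))
      (λ a′ b′ → shadowing-wins _ _ l z′ a′ b′ a b (ℕ.n<1+n _) (ℕ.n<1+n _))

  four-cops-win : CopsHaveWinningStrategy 4
  four-cops-win = cops (vertex A 0ℤ) (vertex A 0ℤ) (vertex A 0ℤ) (vertex A 0ℤ) , win
    where
    win : ∀ r → CopsWin (cops (vertex A 0ℤ) (vertex A 0ℤ) (vertex A 0ℤ) (vertex A 0ℤ)) r
    win r with vertex-surjective r
    ... | l , z , refl with positive-residue z
    -- All cops start at index 0, which is congruent to `z - suc e`; the first turn only restates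
    -- this as a lag with `p = 0`.
    ...   | e , n∣z-e = regroup l z 0ℤ 0ℤ ready ready
              (λ a b → catching-up-wins (suc e) _ l z a b 0ℤ (ℕ.n<1+n _))
      where
      lemma : ∀ z e k → - (z - e) ≡ 0ℤ - (z + (- e + 0ℤ * k))
      lemma = solve-∀
      ready : MoveTo (vertex A 0ℤ) (vertex A (z + lag (suc e) 0ℤ))
      ready = MoveTo-stay A (subst (+ n ∣_) (lemma z (+ suc e) (+ k)) (∣m⇒∣-m n∣z-e))

-- Words for walks, and finite checks on closed walks.

Word : Set
Word = List Port

-- After a step along `p`, `back p` undoes it, and `first p` and `second p` are the two ways onward.
back first second : Port → Port
back next  = prev
back prev  = next
back spoke = spoke
first next  = next
first prev  = prev
first spoke = next
second next  = spoke
second prev  = spoke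
second spoke = prev

port-cases : ∀ p q → q ≡ back p ⊎ q ≡ first p ⊎ q ≡ second p
port-cases next  next  = inj₂ (inj₁ refl)
port-cases next  prev  = inj₁ refl
port-cases next  spoke = inj₂ (inj₂ refl)
port-cases prev  next  = inj₁ refl
port-cases prev  prev  = inj₂ (inj₁ refl)
port-cases prev  spoke = inj₂ (inj₂ refl)
port-cases spoke next  = inj₂ (inj₁ refl)
port-cases spoke prev  = inj₂ (inj₂ refl)
port-cases spoke spoke = inj₁ refl

-- Words of length 1 to d without backtracking that start with p.
paths : ℕ → Port → List Word
paths zero    p = []
paths (suc d) p = (p ∷ []) ∷ map (p ∷_) (paths d (first p) ++ paths d (second p))

-- Seen from `u`, the walks by which a cop blocks the edge `q` at the far end of `p`.
branch : Port → Port → List Word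
branch p q = map (p ∷_) (paths 3 q)

endLevel : Word → Level → Level
endLevel []          l = l
endLevel (next  ∷ w) l = endLevel w l
endLevel (prev  ∷ w) l = endLevel w l
endLevel (spoke ∷ w) l = endLevel w (other l)

unit : Level → Level → ℤ
unit A A = 1ℤ
unit A B = 0ℤ
unit B A = 0ℤ
unit B B = 1ℤ

-- The net number of steps that a word started on level l makes along the edges of level m.
travel : Level → Word → Level → ℤ
travel m []          l = 0ℤ
travel m (next  ∷ w) l = unit m l + travel m w l
travel m (prev  ∷ w) l = - unit m l + travel m w l
travel m (spoke ∷ w) l = travel m w (other l)

_≟ᴸ_ : (l m : Level) → Dec (l ≡ m)
A ≟ᴸ A = yes refl
A ≟ᴸ B = no λ ()
B ≟ᴸ A = no λ ()
B ≟ᴸ B = yes refl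

_≟ᴾ_ : (p q : Port) → Dec (p ≡ q)
next  ≟ᴾ next  = yes refl
next  ≟ᴾ prev  = no λ ()
next  ≟ᴾ spoke = no λ ()
prev  ≟ᴾ next  = no λ ()
prev  ≟ᴾ prev  = yes refl
prev  ≟ᴾ spoke = no λ ()
spoke ≟ᴾ next  = no λ ()
spoke ≟ᴾ prev  = no λ ()
spoke ≟ᴾ spoke = yes refl

∀-level? : ∀ {P : Level → Set} → (∀ l → Dec (P l)) → Dec (∀ l → P l)
∀-level? P? = map′ (λ { (a , b) A → a ; (a , b) B → b }) (λ f → f A , f B) (P? A ×-dec P? B)

∀-port? : ∀ {P : Port → Set} → (∀ p → Dec (P p)) → Dec (∀ p → P p)
∀-port? P? = map′ (λ { (a , b , c) next → a ; (a , b , c) prev → b ; (a , b , c) spoke → c })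
                  (λ f → f next , f prev , f spoke) (P? next ×-dec P? prev ×-dec P? spoke)

-- Range in which x + y k ≡ 0 (mod n) forces x = 0 and 7 ∣ y.
Short : ℤ → ℤ → Set
Short x y = ∣ x ∣ ℕ.+ ∣ y ∣ ℕ.≤ 6 ⊎ (y ≡ 0ℤ × ∣ x ∣ ℕ.≤ 8) ⊎ x ≡ 0ℤ

-- A criterion free of `n` and `k`, hence checkable by computation, for two walks from level `l` to
-- end at different vertices: the levels differ, or the displacements differ by a short `x + y k`
-- outside the kernel.
Apart : Level → Word → Word → Set
Apart l v w = endLevel v l ≢ endLevel w l ⊎ Short x y × ¬ (x ≡ 0ℤ × 7 ℕ.∣ ∣ y ∣)
  where
  x = travel A v l - travel A w l
  y = travel B v l - travel B w l

apart? : ∀ l v w → Dec (Apart l v w)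
apart? l v w = ¬? (endLevel v l ≟ᴸ endLevel w l) ⊎-dec
  ((∣ x ∣ ℕ.+ ∣ y ∣ ℕ.≤? 6 ⊎-dec (y ℤ.≟ 0ℤ ×-dec ∣ x ∣ ℕ.≤? 8) ⊎-dec x ℤ.≟ 0ℤ) ×-dec
   ¬? (x ℤ.≟ 0ℤ ×-dec 7 ℕ.∣? ∣ y ∣))
  where
  x = travel A v l - travel A w l
  y = travel B v l - travel B w l

Disjoint : Level → List Word → List Word → Set
Disjoint l S T = All (λ v → All (Apart l v) T) S

disjoint? : ∀ l S T → Dec (Disjoint l S T)
disjoint? l S T = All.all? (λ v → All.all? (apart? l v) T) S

abstract

  -- The closed walks excluded by the next three facts have length at most 6.

  branches-disjoint : ∀ l p → Disjoint l (branch p (first p)) (branch p (second p))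
  branches-disjoint = from-yes (∀-level? λ l → ∀-port? λ p → disjoint? l (branch p (first p)) (branch p (second p)))

  branch-paths-disjoint : ∀ l p q → p ≢ q →
    Disjoint l (branch p (first p)) (paths 2 q) × Disjoint l (branch p (second p)) (paths 2 q)
  branch-paths-disjoint = from-yes (∀-level? λ l → ∀-port? λ p → ∀-port? λ q →
    ¬? (p ≟ᴾ q) →-dec (disjoint? l (branch p (first p)) (paths 2 q) ×-dec disjoint? l (branch p (second p)) (paths 2 q)))

  paths-disjoint : ∀ l p q → p ≢ q → Disjoint l (paths 2 p) (paths 2 q)
  paths-disjoint = from-yes (∀-level? λ l → ∀-port? λ p → ∀-port? λ q →
    ¬? (p ≟ᴾ q) →-dec disjoint? l (paths 2 p) (paths 2 q))

  -- Two closed walks of length at most 8 that extend the same path of length 2 share a further edge next to it.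
  no-two-cycles : ∀ l p q → p ≢ q →
    (Disjoint l (branch p (first p)) (branch q (first q)) ⊎ Disjoint l (branch p (second p)) (branch q (second q))) ×
    (Disjoint l (branch p (first p)) (branch q (second q)) ⊎ Disjoint l (branch p (second p)) (branch q (first q)))
  no-two-cycles = from-yes (∀-level? λ l → ∀-port? λ p → ∀-port? λ q →
    ¬? (p ≟ᴾ q) →-dec
    ((disjoint? l (branch p (first p)) (branch q (first q)) ⊎-dec disjoint? l (branch p (second p)) (branch q (second q))) ×-dec
     (disjoint? l (branch p (first p)) (branch q (second q)) ⊎-dec disjoint? l (branch p (second p)) (branch q (first q)))))

-- By the pigeonhole principle `w`, `x`, `y`, `z` cannot all differ.
third : ∀ {m} → m ℕ.< 4 → {x y z : Fin m} → x ≢ y → x ≢ z → y ≢ z → ∀ w → w ≡ x ⊎ w ≡ y ⊎ w ≡ z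
third {m} m<4 {x} {y} {z} x≢y x≢z y≢z w with w Fin.≟ x | w Fin.≟ y | w Fin.≟ z
... | yes w≡x | _       | _       = inj₁ w≡x
... | no  _   | yes w≡y | _       = inj₂ (inj₁ w≡y)
... | no  _   | no  _   | yes w≡z = inj₂ (inj₂ w≡z)
... | no  w≢x | no  w≢y | no  w≢z = ⊥-elim (distinct (Fin.pigeonhole m<4 pick))
  where
  pick : Fin 4 → Fin m
  pick Fin.zero                               = w
  pick (Fin.suc Fin.zero)                     = x
  pick (Fin.suc (Fin.suc Fin.zero))           = y
  pick (Fin.suc (Fin.suc (Fin.suc Fin.zero))) = z
  distinct : ¬ (∃ λ i → ∃ λ j → i Fin.< j × pick i ≡ pick j)
  distinct (Fin.zero , Fin.suc Fin.zero , _ , eq)                               = w≢x eq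
  distinct (Fin.zero , Fin.suc (Fin.suc Fin.zero) , _ , eq)                     = w≢y eq
  distinct (Fin.zero , Fin.suc (Fin.suc (Fin.suc Fin.zero)) , _ , eq)           = w≢z eq
  distinct (Fin.suc Fin.zero , Fin.suc (Fin.suc Fin.zero) , _ , eq)             = x≢y eq
  distinct (Fin.suc Fin.zero , Fin.suc (Fin.suc (Fin.suc Fin.zero)) , _ , eq)   = x≢z eq
  distinct (Fin.suc (Fin.suc Fin.zero) , Fin.suc (Fin.suc (Fin.suc Fin.zero)) , _ , eq) = y≢z eq
  distinct (Fin.suc Fin.zero , Fin.suc Fin.zero , i<j , _) = ℕ.<-irrefl refl i<j
  distinct (Fin.suc (Fin.suc Fin.zero) , Fin.suc Fin.zero , ℕ.s≤s () , _)
  distinct (Fin.suc (Fin.suc Fin.zero) , Fin.suc (Fin.suc Fin.zero) , i<j , _) = ℕ.<-irrefl refl i<j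
  distinct (Fin.suc (Fin.suc (Fin.suc Fin.zero)) , Fin.suc Fin.zero , ℕ.s≤s () , _)
  distinct (Fin.suc (Fin.suc (Fin.suc Fin.zero)) , Fin.suc (Fin.suc Fin.zero) , ℕ.s≤s (ℕ.s≤s ()) , _)
  distinct (Fin.suc (Fin.suc (Fin.suc Fin.zero)) , Fin.suc (Fin.suc (Fin.suc Fin.zero)) , i<j , _) = ℕ.<-irrefl refl i<j

-- Fewer than four cops lose.

module Evasion (n k : ℕ) .{{_ : NonZero n}} (1<n : 1 ℕ.< n) (k<n : k ℕ.< n) (15<n : 15 ℕ.< n)
  (short-kernel : ∀ x y → Short x y → + n ∣ x + y * + k → x ≡ 0ℤ × 7 ℕ.∣ ∣ y ∣) where

  open Cover n k
  open Moves 1<n k<n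

  run : Word → State → State
  run []      u = u
  run (p ∷ w) u = run w (step p u)

  run-travel : ∀ w l z → run w (l , z) ≡ (endLevel w l , z + (travel A w l + travel B w l * + k))
  run-travel [] l z = cong (l ,_) (lemma z (+ k))
    where
    lemma : ∀ z k → z ≡ z + (0ℤ + 0ℤ * k)
    lemma = solve-∀
  run-travel (next ∷ w) A z = trans (run-travel w A (z + 1ℤ)) (cong (endLevel w A ,_) (lemma z (travel A w A) (travel B w A) (+ k)))
    where
    lemma : ∀ z x y k → z + 1ℤ + (x + y * k) ≡ z + (1ℤ + x + (0ℤ + y) * k)
    lemma = solve-∀
  run-travel (next ∷ w) B z = trans (run-travel w B (z + + k)) (cong (endLevel w B ,_) (lemma z (travel A w B) (travel B w B) (+ k)))
    where
    lemma : ∀ z x y k → z + k + (x + y * k) ≡ z + (0ℤ + x + (1ℤ + y) * k)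
    lemma = solve-∀
  run-travel (prev ∷ w) A z = trans (run-travel w A (z - 1ℤ)) (cong (endLevel w A ,_) (lemma z (travel A w A) (travel B w A) (+ k)))
    where
    lemma : ∀ z x y k → z - 1ℤ + (x + y * k) ≡ z + (- 1ℤ + x + (0ℤ + y) * k)
    lemma = solve-∀
  run-travel (prev ∷ w) B z = trans (run-travel w B (z - + k)) (cong (endLevel w B ,_) (lemma z (travel A w B) (travel B w B) (+ k)))
    where
    lemma : ∀ z x y k → z - k + (x + y * k) ≡ z + (0ℤ + x + (- 1ℤ + y) * k)
    lemma = solve-∀
  run-travel (spoke ∷ w) l z = run-travel w (other l) z

  step-back : ∀ p u → step (back p) (step p u) ≡ u
  step-back next  (l , z) = cong (l ,_) (lemma z (stride l))
    where
    lemma : ∀ z s → z + s - s ≡ z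
    lemma = solve-∀
  step-back prev  (l , z) = cong (l ,_) (lemma z (stride l))
    where
    lemma : ∀ z s → z - s + s ≡ z
    lemma = solve-∀
  step-back spoke (A , z) = refl
  step-back spoke (B , z) = refl

  apart⇒≢ : ∀ {l z} v w → Apart l v w → π (run v (l , z)) ≢ π (run w (l , z))
  apart⇒≢ {l} {z} v w apart eq
    with vertex-injective _ _ (trans (sym (cong π (run-travel v l z))) (trans eq (cong π (run-travel w l z))))
  ... | levels≡ , n∣ with apart
  ...   | inj₁ levels≢         = levels≢ levels≡
  ...   | inj₂ (short , ¬zero) = ¬zero (short-kernel _ _ short
          (subst (+ n ∣_) (lemma z (travel A v l) (travel B v l) (travel A w l) (travel B w l) (+ k)) n∣))
    where
    lemma : ∀ z x y x′ y′ k → z + (x + y * k) - (z + (x′ + y′ * k)) ≡ x - x′ + (y - y′) * k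
    lemma = solve-∀

  On : GPVertex n → State → List Word → Set
  On v u S = Any (λ w → v ≡ π (run w u)) S

  on? : ∀ v u S → Dec (On v u S)
  on? v u S = Any.any? (λ w → Sum.≡-dec Fin._≟_ Fin._≟_ v (π (run w u))) S

  apart⇒¬on : ∀ {l z v T} w → All (Apart l w) T → v ≡ π (run w (l , z)) → ¬ On v (l , z) T
  apart⇒¬on w (apart ∷ _)  eq (here {x = w′} eq′) = apart⇒≢ w w′ apart (trans (sym eq) eq′)
  apart⇒¬on w (_ ∷ aparts) eq (there on)          = apart⇒¬on w aparts eq on

  disjoint⇒⊥ : ∀ {l z v S T} → Disjoint l S T → On v (l , z) S → On v (l , z) T → ⊥
  disjoint⇒⊥ (aparts ∷ _)   (here {x = w} eq) onT = apart⇒¬on w aparts eq onT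
  disjoint⇒⊥ (_ ∷ disjoint) (there on)        onT = disjoint⇒⊥ disjoint on onT

  paths-cases : ∀ {v u} d p → On v u (paths (suc d) p) →
    v ≡ π (step p u) ⊎ On v (step p u) (paths d (first p)) ⊎ On v (step p u) (paths d (second p))
  paths-cases d p (here eq)  = inj₁ eq
  paths-cases d p (there on) = inj₂ (Any.++⁻ (paths d (first p)) (Any.map⁻ on))

  paths-first : ∀ {v u} d p → On v (step p u) (paths d (first p)) → On v u (paths (suc d) p)
  paths-first d p on = there (Any.map⁺ (Any.++⁺ˡ on))

  paths-second : ∀ {v u} d p → On v (step p u) (paths d (second p)) → On v u (paths (suc d) p)
  paths-second d p on = there (Any.map⁺ (Any.++⁺ʳ (paths d (first p)) on))

  -- A move prolongs the path, keeps its end, or undoes its last edge; only undoing a path of length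
  -- 1 leaves the paths through `p`, and it leads to `u`.
  paths-extend : ∀ {v w} d p u → On v u (paths d p) → MoveTo v w → On w u (paths (suc d) p) ⊎ w ≡ π u
  paths-extend (suc d) p u on m with paths-cases d p on
  ... | inj₁ refl with neighbours (step p u) m
  ...   | inj₁ eq       = inj₁ (here eq)
  ...   | inj₂ (q , eq) with port-cases p q
  ...     | inj₁ refl        = inj₂ (trans eq (cong π (step-back p u)))
  ...     | inj₂ (inj₁ refl) = inj₁ (paths-first (suc d) p (here eq))
  ...     | inj₂ (inj₂ refl) = inj₁ (paths-second (suc d) p (here eq))
  paths-extend (suc d) p u on m | inj₂ (inj₁ on′) with paths-extend d (first p) (step p u) on′ m
  ...   | inj₁ on″ = inj₁ (paths-first (suc d) p on″)
  ...   | inj₂ eq  = inj₁ (here eq)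
  paths-extend (suc d) p u on m | inj₂ (inj₂ on′) with paths-extend d (second p) (step p u) on′ m
  ...   | inj₁ on″ = inj₁ (paths-second (suc d) p on″)
  ...   | inj₂ eq  = inj₁ (here eq)

  -- The robber at u is not in danger: before a move of the cops (Safe), and before his own move (Free).
  Safe Free : ∀ {m} → Cops m → State → Set
  Safe cs u = (∀ j → ¬ MoveTo (π u) (cs j)) × ∃ λ p → ∀ j → ¬ On (cs j) u (paths 3 p)
  Free cs u = (∀ j → cs j ≢ π u) × ∃ λ p → ∀ j → ¬ On (cs j) u (paths 2 p)

  -- Undoing a cop's move turns a path of length at most 2 along `p` into one of length at most 3,
  -- or puts the cop on `u`; `Safe` excludes both.
  safe⇒free : ∀ {m} {cs cs′ : Cops m} u → CopsMove cs cs′ → Safe cs u → Free cs′ u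
  safe⇒free u move (far , p , clear) =
    (λ j eq → far j (MoveTo-sym (subst (MoveTo _) eq (move j)))) , p , λ j on → clear′ j (paths-extend 2 p u on (MoveTo-sym (move j)))
    where
    clear′ : ∀ j → On _ u (paths 3 p) ⊎ _ ≡ π u → ⊥
    clear′ j (inj₁ on) = clear j on
    clear′ j (inj₂ eq) = far j (inj₁ (sym eq))

  blocked : ∀ {m} {cs : Cops m} u → (∀ j → ¬ MoveTo (π u) (cs j)) → ¬ Safe cs u → ∀ p → ∃ λ j → On (cs j) u (paths 3 p)
  blocked {cs = cs} u far ¬safe p with Fin.any? (λ j → on? (cs j) u (paths 3 p))
  ... | yes found = found
  ... | no  none  = ⊥-elim (¬safe (far , p , λ j on → none (j , on)))

  module _ {m} (m<4 : m ℕ.< 4) (cs : Cops m) (u : State) (off : ∀ j → cs j ≢ π u)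
           (¬safe : ∀ p → ¬ Safe cs (step p u)) where

    private
      l : Level
      l = proj₁ u

    adjacent⇒on : ∀ {v} p → v ≢ π u → MoveTo (π (step p u)) v → On v u (paths 2 p)
    adjacent⇒on p v≢u m with paths-extend 1 p u (here refl) m
    ... | inj₁ on = on
    ... | inj₂ eq = ⊥-elim (v≢u eq)

    -- The cops `x`, `y`, `z` are distinct, hence all there are, and none is next to the far end of
    -- `q`. So both onward edges of `q` are blocked: not by `z`, and not both by one cop. Thus `x`
    -- and `y` block them in one of two pairings, and `no-two-cycles` refutes each.
    cornered : ∀ p q r → p ≢ q → p ≢ r → q ≢ r → ∀ x y z →
      On (cs x) u (branch p (first p)) → On (cs y) u (branch p (second p)) → On (cs z) u (paths 2 r) → ⊥
    cornered p q r p≢q p≢r q≢r x y z onx ony onz =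
      surround (blocked (step q u) far (¬safe q) (first q)) (blocked (step q u) far (¬safe q) (second q))
      where
      only : ∀ j → j ≡ x ⊎ j ≡ y ⊎ j ≡ z
      only = third m<4
        (λ { refl → disjoint⇒⊥ (branches-disjoint l p) onx ony })
        (λ { refl → disjoint⇒⊥ (proj₁ (branch-paths-disjoint l p r p≢r)) onx onz })
        (λ { refl → disjoint⇒⊥ (proj₂ (branch-paths-disjoint l p r p≢r)) ony onz })
      far : ∀ j → ¬ MoveTo (π (step q u)) (cs j)
      far j m with adjacent⇒on q (off j) m | only j
      ... | on | inj₁ refl        = disjoint⇒⊥ (proj₁ (branch-paths-disjoint l p q p≢q)) onx on
      ... | on | inj₂ (inj₁ refl) = disjoint⇒⊥ (proj₂ (branch-paths-disjoint l p q p≢q)) ony on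
      ... | on | inj₂ (inj₂ refl) = disjoint⇒⊥ (paths-disjoint l q r q≢r) on onz
      surround : (∃ λ j → On (cs j) (step q u) (paths 3 (first q))) →
                 (∃ λ j → On (cs j) (step q u) (paths 3 (second q))) → ⊥
      surround (i , oni) (j , onj) with Any.map⁺ {f = q ∷_} oni | Any.map⁺ {f = q ∷_} onj | only i | only j
      ... | oni′ | onj′ | inj₂ (inj₂ refl) | _                = disjoint⇒⊥ (proj₁ (branch-paths-disjoint l q r q≢r)) oni′ onz
      ... | oni′ | onj′ | _                | inj₂ (inj₂ refl) = disjoint⇒⊥ (proj₂ (branch-paths-disjoint l q r q≢r)) onj′ onz
      ... | oni′ | onj′ | inj₁ refl        | inj₁ refl        = disjoint⇒⊥ (branches-disjoint l q) oni′ onj′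
      ... | oni′ | onj′ | inj₂ (inj₁ refl) | inj₂ (inj₁ refl) = disjoint⇒⊥ (branches-disjoint l q) oni′ onj′
      ... | oni′ | onj′ | inj₁ refl        | inj₂ (inj₁ refl) with proj₁ (no-two-cycles l p q p≢q)
      ...   | inj₁ d = disjoint⇒⊥ d onx oni′
      ...   | inj₂ d = disjoint⇒⊥ d ony onj′
      surround (i , oni) (j , onj) | oni′ | onj′ | inj₂ (inj₁ refl) | inj₁ refl with proj₂ (no-two-cycles l p q p≢q)
      ...   | inj₁ d = disjoint⇒⊥ d onx onj′
      ...   | inj₂ d = disjoint⇒⊥ d ony oni′

    -- No cop is next to the far end of `p`, so that vertex is unsafe only if all three of its edges
    -- are blocked; the cop behind `back p` supplies `z` and `r` for `cornered`.
    escape : (∃ λ p → ∀ j → ¬ On (cs j) u (paths 2 p)) → ⊥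
    escape (p , clear) = close (surround (first p)) (surround (second p)) (surround (back p))
      where
      far : ∀ j → ¬ MoveTo (π (step p u)) (cs j)
      far j m = clear j (adjacent⇒on p (off j) m)
      surround : ∀ q → ∃ λ j → On (cs j) (step p u) (paths 3 q)
      surround = blocked (step p u) far (¬safe p)
      other-ports : ∀ p → p ≢ first (back p) × p ≢ second (back p) × first (back p) ≢ second (back p)
      other-ports next  = (λ ()) , (λ ()) , (λ ())
      other-ports prev  = (λ ()) , (λ ()) , (λ ())
      other-ports spoke = (λ ()) , (λ ()) , (λ ())
      close : (∃ λ j → On (cs j) (step p u) (paths 3 (first p))) → (∃ λ j → On (cs j) (step p u) (paths 3 (second p))) →
              (∃ λ j → On (cs j) (step p u) (paths 3 (back p))) → ⊥
      -- A path along `back p` passes through `u`: it ends there, which `off` excludes, or goes on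
      -- for at most two edges through a port other than `p`.
      close (x , onx) (y , ony) (z , onz) with paths-cases 2 (back p) onz | other-ports p
      ... | inj₁ eq | _ = off z (trans eq (cong π (step-back p u)))
      ... | inj₂ (inj₁ onz′) | p≢q , p≢r , q≢r =
        cornered p _ _ p≢r p≢q (≢-sym q≢r) x y z (Any.map⁺ {f = p ∷_} onx) (Any.map⁺ {f = p ∷_} ony) (subst (λ w → On (cs z) w (paths 2 (first (back p)))) (step-back p u) onz′)
      ... | inj₂ (inj₂ onz′) | p≢q , p≢r , q≢r =
        cornered p _ _ p≢q p≢r q≢r x y z (Any.map⁺ {f = p ∷_} onx) (Any.map⁺ {f = p ∷_} ony) (subst (λ w → On (cs z) w (paths 2 (second (back p)))) (step-back p u) onz′)

  -- Induction on the cops' strategy: every safe step would contradict the induction hypothesis, so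
  -- no step is safe, against `escape`.
  safe⇒¬win : ∀ {m} → m ℕ.< 4 → (cs : Cops m) → ∀ u {r} → r ≡ π u → Safe cs u → CopsWin cs r → ⊥
  safe⇒¬win m<4 cs u refl (far , _) (capture cs′ move (j , eq)) = far j (MoveTo-sym (subst (MoveTo _) eq (move j)))
  safe⇒¬win m<4 cs u refl safe (continue cs′ move win) with safe⇒free u move safe
  ... | off , clear = escape m<4 cs′ u off
    (λ p safe′ → safe⇒¬win m<4 cs′ (step p u) refl safe′ (win (π (step p u)) (step-adjacent p u))) clear

  -- With the spoke as unwatched edge, a robber at a rim vertex is threatened from five vertices on each level,
  -- so a cop spoils at most five of the n rim vertices as a start.
  zone : Level → Fin 5 → Word
  zone A Fin.zero                                             = []
  zone A (Fin.suc Fin.zero)                                   = next ∷ []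
  zone A (Fin.suc (Fin.suc Fin.zero))                         = prev ∷ []
  zone A (Fin.suc (Fin.suc (Fin.suc Fin.zero)))               = spoke ∷ next ∷ spoke ∷ []
  zone A (Fin.suc (Fin.suc (Fin.suc (Fin.suc Fin.zero))))     = spoke ∷ prev ∷ spoke ∷ []
  zone B Fin.zero                                             = spoke ∷ []
  zone B (Fin.suc Fin.zero)                                   = spoke ∷ next ∷ []
  zone B (Fin.suc (Fin.suc Fin.zero))                         = spoke ∷ prev ∷ []
  zone B (Fin.suc (Fin.suc (Fin.suc Fin.zero)))               = spoke ∷ next ∷ next ∷ []
  zone B (Fin.suc (Fin.suc (Fin.suc (Fin.suc Fin.zero))))     = spoke ∷ prev ∷ prev ∷ []

  endLevel-zone : ∀ l i → endLevel (zone l i) A ≡ l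
  endLevel-zone A Fin.zero                                         = refl
  endLevel-zone A (Fin.suc Fin.zero)                               = refl
  endLevel-zone A (Fin.suc (Fin.suc Fin.zero))                     = refl
  endLevel-zone A (Fin.suc (Fin.suc (Fin.suc Fin.zero)))           = refl
  endLevel-zone A (Fin.suc (Fin.suc (Fin.suc (Fin.suc Fin.zero)))) = refl
  endLevel-zone B Fin.zero                                         = refl
  endLevel-zone B (Fin.suc Fin.zero)                               = refl
  endLevel-zone B (Fin.suc (Fin.suc Fin.zero))                     = refl
  endLevel-zone B (Fin.suc (Fin.suc (Fin.suc Fin.zero)))           = refl
  endLevel-zone B (Fin.suc (Fin.suc (Fin.suc (Fin.suc Fin.zero)))) = refl

  InZone : GPVertex n → State → Set
  InZone v u = (∃ λ i → v ≡ π (run (zone A i) u)) ⊎ (∃ λ i → v ≡ π (run (zone B i) u))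

  inZone? : ∀ v u → Dec (InZone v u)
  inZone? v u = Fin.any? (λ i → Sum.≡-dec Fin._≟_ Fin._≟_ v (π (run (zone A i) u))) ⊎-dec
                Fin.any? (λ i → Sum.≡-dec Fin._≟_ Fin._≟_ v (π (run (zone B i) u)))

  outside⇒safe : ∀ {m} (cs : Cops m) u → (∀ j → ¬ InZone (cs j) u) → Safe cs u
  outside⇒safe cs u outside = (λ j m → outside j (near (neighbours u m))) , spoke , λ j on → outside j (along on)
    where
    near : ∀ {v} → v ≡ π u ⊎ (∃ λ p → v ≡ π (step p u)) → InZone v u
    near (inj₁ eq)           = inj₁ (Fin.zero , eq)
    near (inj₂ (next , eq))  = inj₁ (Fin.suc Fin.zero , eq)
    near (inj₂ (prev , eq))  = inj₁ (Fin.suc (Fin.suc Fin.zero) , eq)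
    near (inj₂ (spoke , eq)) = inj₂ (Fin.zero , eq)
    along : ∀ {v} → On v u (paths 3 spoke) → InZone v u
    along (here eq)                                                   = inj₂ (Fin.zero , eq)
    along (there (here eq))                                           = inj₂ (Fin.suc Fin.zero , eq)
    along (there (there (here eq)))                                   = inj₂ (Fin.suc (Fin.suc (Fin.suc Fin.zero)) , eq)
    along (there (there (there (here eq))))                           = inj₁ (Fin.suc (Fin.suc (Fin.suc Fin.zero)) , eq)
    along (there (there (there (there (here eq)))))                   = inj₂ (Fin.suc (Fin.suc Fin.zero) , eq)
    along (there (there (there (there (there (here eq))))))           = inj₂ (Fin.suc (Fin.suc (Fin.suc (Fin.suc Fin.zero))) , eq)
    along (there (there (there (there (there (there (here eq)))))))   = inj₁ (Fin.suc (Fin.suc (Fin.suc (Fin.suc Fin.zero))) , eq)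

  slot : ∀ {v u} → InZone v u → Fin 5
  slot (inj₁ (i , _)) = i
  slot (inj₂ (i , _)) = i

  same-zone : ∀ {v} l m i x y → v ≡ π (run (zone l i) (A , x)) → v ≡ π (run (zone m i) (A , y)) → + n ∣ x - y
  same-zone l m i x y eq eq′
    with vertex-injective _ _ (trans (sym (cong π (run-travel (zone l i) A x))) (trans (trans (sym eq) eq′) (cong π (run-travel (zone m i) A y))))
  ... | levels≡ , n∣ with trans (sym (endLevel-zone l i)) (trans levels≡ (endLevel-zone m i))
  ...   | refl = subst (+ n ∣_) (lemma x y (travel A (zone l i) A + travel B (zone l i) A * + k)) n∣
    where
    lemma : ∀ x y d → x + d - (y + d) ≡ x - y
    lemma = solve-∀

  -- The level of `v` and the slot determine the word, and a fixed word translates the index, so the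
  -- start is determined modulo `n`.
  same-slot : ∀ {v x y} (a : InZone v (A , x)) (b : InZone v (A , y)) → slot a ≡ slot b → + n ∣ x - y
  same-slot (inj₁ (i , eq)) (inj₁ (.i , eq′)) refl = same-zone A A i _ _ eq eq′
  same-slot (inj₁ (i , eq)) (inj₂ (.i , eq′)) refl = same-zone A B i _ _ eq eq′
  same-slot (inj₂ (i , eq)) (inj₁ (.i , eq′)) refl = same-zone B A i _ _ eq eq′
  same-slot (inj₂ (i , eq)) (inj₂ (.i , eq′)) refl = same-zone B B i _ _ eq eq′

  -- Each of the `n` rim indices would be charged to a cop and a slot, but there are at most 15 such
  -- pairs.
  threatened : ∀ {m} → m ℕ.< 4 → (cs : Cops m) → ¬ (∀ (x : Fin n) → ∃ λ j → InZone (cs j) (A , + toℕ x))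
  threatened {m} m<4 cs threat with Fin.pigeonhole 5m<n (λ x → Fin.combine (proj₁ (threat x)) (slot (proj₂ (threat x))))
    where
    5m<n : m ℕ.* 5 ℕ.< n
    5m<n = ℕ.≤-<-trans (ℕ.*-monoˡ-≤ 5 (ℕ.s≤s⁻¹ m<4)) 15<n
  ... | x , y , x<y , eq with threat x | threat y | Fin.combine-injective (proj₁ (threat x)) _ (proj₁ (threat y)) _ eq
  ...   | i , a | .i , b | refl , slots≡ =
    ℕ.<⇒≢ x<y (∣-small _ _ (Fin.toℕ<n x) (Fin.toℕ<n y) (same-slot a b slots≡))

  start : ∀ {m} → m ℕ.< 4 → (cs : Cops m) → ∃ λ u → Safe cs u
  start {m} m<4 cs with Fin.any? (λ (x : Fin n) → Fin.all? (λ j → ¬? (inZone? (cs j) (A , + toℕ x))))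
  ... | yes (x , outside) = (A , + toℕ x) , outside⇒safe cs _ outside
  ... | no  none          = ⊥-elim (threatened m<4 cs threat)
    where
    threat : ∀ (x : Fin n) → ∃ λ j → InZone (cs j) (A , + toℕ x)
    threat x with Fin.any? (λ j → inZone? (cs j) (A , + toℕ x))
    ... | yes found = found
    ... | no  clear = ⊥-elim (none (x , λ j inZone → clear (j , inZone)))

  fewer-than-four-cops-lose : ∀ m → m ℕ.< 4 → ¬ CopsHaveWinningStrategy m
  fewer-than-four-cops-lose m m<4 (cs , win) with start m<4 cs
  ... | u , safe = safe⇒¬win m<4 cs u refl safe (win (π u))

-- Arithmetic of `n = 7 m` and `k = i m`.

7-prime : Prime 7
7-prime = from-yes (prime? 7)

-- `wide` serves `n ≥ 42`, `two` serves (28,8) and (35,10), and `three` serves (35,15).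
data Admissible (m : ℕ) : ℕ → Set where
  wide  : ∀ {i} → 6 ℕ.≤ m → .{{NonZero i}} → i ℕ.< 7 → Admissible m i
  two   : 4 ℕ.≤ m → Admissible m 2
  three : 5 ℕ.≤ m → Admissible m 3

admissible-i : ∀ {m i} → Admissible m i → ¬ 7 ℕ.∣ i
admissible-i (wide _ i<7) = ℕ.>⇒∤ i<7
admissible-i (two _)      = from-no (7 ℕ.∣? 2)
admissible-i (three _)    = from-no (7 ℕ.∣? 3)

admissible-m : ∀ {m i} → Admissible m i → 4 ℕ.≤ m
admissible-m (wide 6≤m _) = ℕ.≤-trans (ℕ.m≤m+n 4 2) 6≤m
admissible-m (two 4≤m)    = 4≤m
admissible-m (three 5≤m)  = ℕ.≤-trans (ℕ.m≤m+n 4 1) 5≤m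

∣y∣-bound : ∀ {m b y} → m ℕ.+ y ℕ.≤ 6 → b ℕ.≤ m → y ℕ.≤ 6 ℕ.∸ b
∣y∣-bound {m} {b} {y} m+y≤6 b≤m =
  subst (ℕ._≤ 6 ℕ.∸ b) (ℕ.m+n∸m≡n b y) (ℕ.∸-monoˡ-≤ b (ℕ.≤-trans (ℕ.+-monoˡ-≤ y b≤m) m+y≤6))

-- The case `x = ± m`: the bound leaves `∣ y ∣` at most 0, 2 or 1 in the three cases, and then
-- `∣ e + y i ∣` is at most 5 and nonzero.
unit-not-multiple : ∀ {m i} → Admissible m i → ∀ e y → ∣ e ∣ ≡ 1 → m ℕ.+ ∣ y ∣ ℕ.≤ 6 → ¬ 7 ℕ.∣ ∣ e + y * + i ∣
unit-not-multiple (wide {i} 6≤m _) e y ∣e∣≡1 m+y≤6 7∣ with ∣y∣-bound {y = ∣ y ∣} m+y≤6 6≤m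
unit-not-multiple (wide {i} 6≤m _) e (+ 0) ∣e∣≡1 m+y≤6 7∣ | _ =
  from-no (7 ℕ.∣? 1) (subst (7 ℕ.∣_) (trans (cong ∣_∣ (ℤ.+-identityʳ e)) ∣e∣≡1) 7∣)
unit-not-multiple (two 4≤m) e y ∣e∣≡1 m+y≤6 7∣ with ∣y∣-bound {y = ∣ y ∣} m+y≤6 4≤m
unit-not-multiple (two 4≤m) (+ 1) (+ 0) refl m+y≤6 7∣ | _ = from-no (7 ℕ.∣? 1) 7∣
unit-not-multiple (two 4≤m) (+ 1) (+ 1) refl m+y≤6 7∣ | _ = from-no (7 ℕ.∣? 3) 7∣
unit-not-multiple (two 4≤m) (+ 1) (+ 2) refl m+y≤6 7∣ | _ = from-no (7 ℕ.∣? 5) 7∣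
unit-not-multiple (two 4≤m) (+ 1) (-[1+ 0 ]) refl m+y≤6 7∣ | _ = from-no (7 ℕ.∣? 1) 7∣
unit-not-multiple (two 4≤m) (+ 1) (-[1+ 1 ]) refl m+y≤6 7∣ | _ = from-no (7 ℕ.∣? 3) 7∣
unit-not-multiple (two 4≤m) (-[1+ 0 ]) (+ 0) refl m+y≤6 7∣ | _ = from-no (7 ℕ.∣? 1) 7∣
unit-not-multiple (two 4≤m) (-[1+ 0 ]) (+ 1) refl m+y≤6 7∣ | _ = from-no (7 ℕ.∣? 1) 7∣
unit-not-multiple (two 4≤m) (-[1+ 0 ]) (+ 2) refl m+y≤6 7∣ | _ = from-no (7 ℕ.∣? 3) 7∣
unit-not-multiple (two 4≤m) (-[1+ 0 ]) (-[1+ 0 ]) refl m+y≤6 7∣ | _ = from-no (7 ℕ.∣? 3) 7∣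
unit-not-multiple (two 4≤m) (-[1+ 0 ]) (-[1+ 1 ]) refl m+y≤6 7∣ | _ = from-no (7 ℕ.∣? 5) 7∣
unit-not-multiple (two 4≤m) e (+ suc (suc (suc _))) ∣e∣≡1 m+y≤6 7∣ | ℕ.s≤s (ℕ.s≤s ())
unit-not-multiple (two 4≤m) e (-[1+ suc (suc _) ]) ∣e∣≡1 m+y≤6 7∣ | ℕ.s≤s (ℕ.s≤s ())
unit-not-multiple (three 5≤m) e y ∣e∣≡1 m+y≤6 7∣ with ∣y∣-bound {y = ∣ y ∣} m+y≤6 5≤m
unit-not-multiple (three 5≤m) (+ 1) (+ 0) refl m+y≤6 7∣ | _ = from-no (7 ℕ.∣? 1) 7∣
unit-not-multiple (three 5≤m) (+ 1) (+ 1) refl m+y≤6 7∣ | _ = from-no (7 ℕ.∣? 4) 7∣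
unit-not-multiple (three 5≤m) (+ 1) (-[1+ 0 ]) refl m+y≤6 7∣ | _ = from-no (7 ℕ.∣? 2) 7∣
unit-not-multiple (three 5≤m) (-[1+ 0 ]) (+ 0) refl m+y≤6 7∣ | _ = from-no (7 ℕ.∣? 1) 7∣
unit-not-multiple (three 5≤m) (-[1+ 0 ]) (+ 1) refl m+y≤6 7∣ | _ = from-no (7 ℕ.∣? 2) 7∣
unit-not-multiple (three 5≤m) (-[1+ 0 ]) (-[1+ 0 ]) refl m+y≤6 7∣ | _ = from-no (7 ℕ.∣? 4) 7∣
unit-not-multiple (three 5≤m) e (+ suc (suc _)) ∣e∣≡1 m+y≤6 7∣ | ℕ.s≤s ()
unit-not-multiple (three 5≤m) e (-[1+ suc _ ]) ∣e∣≡1 m+y≤6 7∣ | ℕ.s≤s ()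

-- If `∣ e ∣ ≥ 2` then `∣ x ∣ ≥ 8`, beyond the bound 6. If `y = 0` then 7 divides `e`, so
-- `∣ x ∣ ≥ 28`. Finally, `x = 0` is impossible as `m ≥ 4`.
nonzero-multiple-not-short : ∀ {m i} → Admissible m i → ∀ e y → ∣ e ∣ ≢ 0 → 7 ℕ.∣ ∣ e + y * + i ∣ → ¬ Short (e * + m) y
nonzero-multiple-not-short {m} {i} adm e y e≢0 7∣ short = go ∣ e ∣ refl (ℤ.abs-* e (+ m)) short
  where
  4≤m = admissible-m adm
  go : ∀ a → ∣ e ∣ ≡ a → ∣ e * + m ∣ ≡ ∣ e ∣ ℕ.* m → ¬ Short (e * + m) y
  go zero ∣e∣≡ ∣x∣≡ _ = e≢0 ∣e∣≡
  go (suc zero) ∣e∣≡ ∣x∣≡ (inj₁ x+y≤6) = unit-not-multiple adm e y ∣e∣≡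
    (subst (λ t → t ℕ.+ ∣ y ∣ ℕ.≤ 6) (trans ∣x∣≡ (trans (cong (ℕ._* m) ∣e∣≡) (ℕ.*-identityˡ m))) x+y≤6) 7∣
  go (suc (suc a)) ∣e∣≡ ∣x∣≡ (inj₁ x+y≤6) = ℕ.<⇒≱ (ℕ.m≤m+n 7 1) (begin
    8                      ≤⟨ ℕ.*-mono-≤ (ℕ.m≤m+n 2 a) 4≤m ⟩
    suc (suc a) ℕ.* m      ≡⟨ cong (ℕ._* m) ∣e∣≡ ⟨
    ∣ e ∣ ℕ.* m            ≡⟨ ∣x∣≡ ⟨
    ∣ e * + m ∣            ≤⟨ ℕ.m≤m+n _ ∣ y ∣ ⟩
    ∣ e * + m ∣ ℕ.+ ∣ y ∣  ≤⟨ x+y≤6 ⟩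
    6                      ∎)
    where open ℕ.≤-Reasoning
  go (suc a) ∣e∣≡ ∣x∣≡ (inj₂ (inj₁ (refl , x≤8))) = ℕ.<⇒≱ (ℕ.m≤m+n 9 19) (begin
    28           ≤⟨ ℕ.*-mono-≤ 7≤e 4≤m ⟩
    ∣ e ∣ ℕ.* m  ≡⟨ ∣x∣≡ ⟨
    ∣ e * + m ∣  ≤⟨ x≤8 ⟩
    8            ∎)
    where
    open ℕ.≤-Reasoning
    7≤e : 7 ℕ.≤ ∣ e ∣
    7≤e = ℕ.∣⇒≤ {{ℕ.≢-nonZero e≢0}} (subst (λ t → 7 ℕ.∣ ∣ t ∣) (ℤ.+-identityʳ e) 7∣)
  go (suc a) ∣e∣≡ ∣x∣≡ (inj₂ (inj₂ x≡0)) with ℕ.m*n≡0⇒m≡0∨n≡0 ∣ e ∣ (trans (sym ∣x∣≡) (cong ∣_∣ x≡0))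
  ... | inj₁ e≡0  = e≢0 e≡0
  ... | inj₂ refl = ℕ.<⇒≱ (ℕ.s≤s ℕ.z≤n) 4≤m

kernel-factor : ∀ m i x y → + (7 ℕ.* m) ∣ x + y * + (i ℕ.* m) → ∃ λ e → x ≡ e * + m × 7 ℕ.∣ ∣ e + y * + i ∣
-- Solving `x + y i m = 7 q m` for `x` gives `e = 7 q - y i`.
kernel-factor m i x y (divides q eq) = q * + 7 - y * + i , x≡em , ∣⇒∣ᵤ (divides q (lemma₃ q y (+ i) (+ 7)))
  where
  lemma₁ : ∀ x t → x ≡ x + t - t
  lemma₁ = solve-∀
  lemma₂ : ∀ y q m i s → q * (s * m) - y * (i * m) ≡ (q * s - y * i) * m
  lemma₂ = solve-∀
  lemma₃ : ∀ q y i s → q * s - y * i + y * i ≡ q * s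
  lemma₃ = solve-∀
  open ≡-Reasoning
  x≡em : x ≡ (q * + 7 - y * + i) * + m
  x≡em = begin
    x                                              ≡⟨ lemma₁ x (y * + (i ℕ.* m)) ⟩
    x + y * + (i ℕ.* m) - y * + (i ℕ.* m)          ≡⟨ cong (_- y * + (i ℕ.* m)) eq ⟩
    q * + (7 ℕ.* m) - y * + (i ℕ.* m)              ≡⟨ cong₂ (λ s t → q * s - y * t) (ℤ.pos-* 7 m) (ℤ.pos-* i m) ⟩
    q * (+ 7 * + m) - y * (+ i * + m)              ≡⟨ lemma₂ y q (+ m) (+ i) (+ 7) ⟩
    (q * + 7 - y * + i) * + m                      ∎

short-kernel : ∀ {m i} → Admissible m i → ∀ x y → Short x y → + (7 ℕ.* m) ∣ x + y * + (i ℕ.* m) →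
               x ≡ 0ℤ × 7 ℕ.∣ ∣ y ∣
short-kernel {m} {i} adm x y short n∣ with kernel-factor m i x y n∣
... | e , refl , 7∣e+yi with ∣ e ∣ ℕ.≟ 0
...   | no  e≢0 = ⊥-elim (nonzero-multiple-not-short adm e y e≢0 7∣e+yi short)
...   | yes e≡0 with ℤ.∣i∣≡0⇒i≡0 {e} e≡0
...     | refl with euclidsLemma ∣ y ∣ i 7-prime (subst (7 ℕ.∣_) (trans (cong ∣_∣ (ℤ.+-identityˡ (y * + i))) (ℤ.abs-* y (+ i))) 7∣e+yi)
...       | inj₁ 7∣y = refl , 7∣y
...       | inj₂ 7∣i = ⊥-elim (admissible-i adm 7∣i)

admissible : ∀ m i → 1 ℕ.≤ i → i ℕ.≤ 3 →
  42 ℕ.≤ 7 ℕ.* m ⊎ ((7 ℕ.* m ≡ 28 × i ℕ.* m ≡ 8) ⊎ ((7 ℕ.* m ≡ 35 × i ℕ.* m ≡ 10) ⊎ (7 ℕ.* m ≡ 35 × i ℕ.* m ≡ 15))) →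
  Admissible m i
admissible m i 1≤i i≤3 (inj₁ 42≤n) =
  wide (ℕ.*-cancelˡ-≤ 7 42≤n) {{ℕ.>-nonZero 1≤i}} (ℕ.≤-<-trans i≤3 (ℕ.m≤m+n 4 3))
admissible m i 1≤i i≤3 (inj₂ (inj₁ (n≡ , k≡))) with ℕ.*-cancelˡ-≡ m 4 7 n≡
... | refl with ℕ.*-cancelʳ-≡ i 2 4 k≡
...   | refl = two ℕ.≤-refl
admissible m i 1≤i i≤3 (inj₂ (inj₂ (inj₁ (n≡ , k≡)))) with ℕ.*-cancelˡ-≡ m 5 7 n≡
... | refl with ℕ.*-cancelʳ-≡ i 2 5 k≡
...   | refl = two (ℕ.m≤m+n 4 1)
admissible m i 1≤i i≤3 (inj₂ (inj₂ (inj₂ (n≡ , k≡)))) with ℕ.*-cancelˡ-≡ m 5 7 n≡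
... | refl with ℕ.*-cancelʳ-≡ i 3 5 k≡
...   | refl = three ℕ.≤-refl

-- The prime 7 divides `n i` but not `i`, which lies between 1 and 3, so it divides `n`.
parametrise : ∀ n k i → 1 ℕ.≤ i → i ℕ.≤ 3 → n ℕ.* i ≡ 7 ℕ.* k → ∃ λ m → n ≡ 7 ℕ.* m × k ≡ i ℕ.* m
parametrise n k i 1≤i i≤3 ni≡7k with euclidsLemma n i 7-prime (ℕ.divides k (trans ni≡7k (ℕ.*-comm 7 k)))
... | inj₂ 7∣i = ⊥-elim (ℕ.>⇒∤ {{ℕ.>-nonZero 1≤i}} (ℕ.≤-<-trans i≤3 (ℕ.m≤m+n 4 3)) 7∣i)
... | inj₁ (ℕ.divides m refl) = m , ℕ.*-comm m 7 , ℕ.*-cancelˡ-≡ k (i ℕ.* m) 7 (begin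
  7 ℕ.* k           ≡⟨ ni≡7k ⟨
  m ℕ.* 7 ℕ.* i     ≡⟨ cong (ℕ._* i) (ℕ.*-comm m 7) ⟩
  7 ℕ.* m ℕ.* i     ≡⟨ ℕ.*-assoc 7 m i ⟩
  7 ℕ.* (m ℕ.* i)   ≡⟨ cong (7 ℕ.*_) (ℕ.*-comm m i) ⟩
  7 ℕ.* (i ℕ.* m)   ∎)
  where open ≡-Reasoning

theorem2p4 : (n k : ℕ) → 1 ≤ k → 5 ≤ n → 2 ℕ.* k < n →
    Σ ℕ (λ i → (1 ≤ i × i ≤ 3) × n ℕ.* i ≡ 7 ℕ.* k) →
    (42 ≤ n ⊎ ((n ≡ 28 × k ≡ 8) ⊎ ((n ≡ 35 × k ≡ 10) ⊎ (n ≡ 35 × k ≡ 15)))) →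
    GPCopNumberIs n k 4
theorem2p4 n k 1≤k 5≤n 2k<n (i , (1≤i , i≤3) , ni≡7k) large with parametrise n k i 1≤i i≤3 ni≡7k
... | m , refl , refl =
  Pursuit.four-cops-win (7 ℕ.* m) (i ℕ.* m) 1<n k<n ,
  Evasion.fewer-than-four-cops-lose (7 ℕ.* m) (i ℕ.* m) 1<n k<n 15<n (short-kernel adm)
  where
  instance
    n≢0 : NonZero (7 ℕ.* m)
    n≢0 = ℕ.>-nonZero (ℕ.≤-trans (ℕ.m≤m+n 1 4) 5≤n)
  adm : Admissible m i
  adm = admissible m i 1≤i i≤3 large
  1<n : 1 < 7 ℕ.* m
  1<n = ℕ.≤-trans (ℕ.m≤m+n 2 3) 5≤n
  k<n : i ℕ.* m < 7 ℕ.* m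
  k<n = ℕ.≤-<-trans (ℕ.m≤n*m (i ℕ.* m) 2) 2k<n
  15<n : 15 < 7 ℕ.* m
  -- From `m ≥ 4`, `n` is at least 28.
  15<n = ℕ.≤-trans (ℕ.m≤m+n 16 12) (ℕ.*-monoʳ-≤ 7 (admissible-m adm))
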